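{- Let $n\geq 1$, let $t=t(v_1,\ldots,v_n)$ be a Boolean expression (a term in the language of Boolean algebras) in the variables $v_1,\ldots,v_n$, and let $b_1,\ldots,b_n$ be free generators of the free Boolean algebra $\mathbf{\Omega}_n=\mathbf{2}^{2^n}$. Then the element $d=t^{\mathbf{\Omega}_n}(b_1,\ldots,b_n)$ codes the full disjunctive normal form (full DNF) of $t$; that is, writing $d_j$ and $b_i(j)$ for the $j$-th coordinates of $d$ and $b_i$, where $j$ ranges over the $2^n$-element index set of $\mathbf{2}^{2^n}$, the full DNF of $t$ is $$t=\sum_{j:\ d_j=1} v_1^{b_1(j)}\cdots v_n^{b_n(j)}.$$
   Context: $\mathbf{2}$ is the two-element Boolean algebra with domain $2=\{0,1\}$, and $\mathbf{\Omega}_n=\mathbf{2}^{2^n}$ is its power with $2^n$ coordinates (elements are Boolean vectors of length $2^n$, operations are coordinatewise). It is a free Boolean algebra with $n$ free generators. "Free generators $b_1,\ldots,b_n$ of $\mathbf{\Omega}_n$" means that $\{b_1,\ldots,b_n\}$ is a set of $n$ elements freely generating $\mathbf{\Omega}_n$. $t^{\mathbf{\Omega}_n}$ is the interpretation of the term $t$ in $\mathbf{\Omega}_n$. For a variable $v$, $v^1=v$ and $v^0=v'$ (the complement). The sum denotes a join (disjunction) and the product a meet (conjunction); the empty sum is $0$. The full DNF of $t$ is the disjunction of the minterms $v_1^{\mu_1}\cdots v_n^{\mu_n}$ over exactly those $(\mu_1,\ldots,\mu_n)\in 2^n$ with $t^{\mathbf{2}}(\mu_1,\ldots,\mu_n)=1$;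 thus the displayed equality says that $j\mapsto (b_1(j),\ldots,b_n(j))$ maps $\{j: d_j=1\}$ bijectively onto this set of $(\mu_1,\ldots,\mu_n)$. -}

module Defs where

open import Algebra.Lattice.Bundles using (BooleanAlgebra)
open import Algebra.Lattice.Morphism.Structures using (IsLatticeHomomorphism)
open import Data.Bool.Base using (Bool; true; false)
open import Data.Bool.Properties using (∨-∧-booleanAlgebra; _≟_)
open import Data.Fin.Base using (Fin)
open import Data.Fin.Subset.Properties using (∪-∩-booleanAlgebra)
open import Data.List.Base using (List; foldr; map; filter; tabulate; allFin)
open import Data.List.Membership.Propositional using (_∈_)
open import Data.List.Relation.Unary.Unique.Propositional using (Unique)
open import Data.Nat.Base using (ℕ; _^_)
open import Data.Product.Base using (Σ-syntax; _×_)
import Data.Vec.Base as Vec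
open Vec using (Vec; lookup)
open import Function.Bundles using (_⇔_)
open import Level using (0ℓ)
open import Relation.Binary.PropositionalEquality.Core using (_≡_)

open BooleanAlgebra using (Carrier; rawLattice)

infixr 6 _∨ᵗ_
infixr 7 _∧ᵗ_
infix  8 ¬ᵗ_

data Term (n : ℕ) : Set where
  var       : Fin n → Term n
  _∨ᵗ_ _∧ᵗ_ : Term n → Term n → Term n
  ¬ᵗ_       : Term n → Term n
  ⊤ᵗ ⊥ᵗ     : Term n

⟦_⟧ : ∀ {n} → Term n → (A : BooleanAlgebra 0ℓ 0ℓ) → (Fin n → Carrier A) → Carrier A
⟦ var i  ⟧ A ρ = ρ i
⟦ s ∨ᵗ t ⟧ A ρ = BooleanAlgebra._∨_ A (⟦ s ⟧ A ρ) (⟦ t ⟧ A ρ)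
⟦ s ∧ᵗ t ⟧ A ρ = BooleanAlgebra._∧_ A (⟦ s ⟧ A ρ) (⟦ t ⟧ A ρ)
⟦ ¬ᵗ t   ⟧ A ρ = BooleanAlgebra.¬_ A (⟦ t ⟧ A ρ)
⟦ ⊤ᵗ     ⟧ A ρ = BooleanAlgebra.⊤ A
⟦ ⊥ᵗ     ⟧ A ρ = BooleanAlgebra.⊥ A

-- Equality of Boolean expressions: s = t is an identity of Boolean algebras.
infix 4 _≐_
_≐_ : ∀ {n} → Term n → Term n → Set₁
_≐_ {n} s t = (A : BooleanAlgebra 0ℓ 0ℓ) (ρ : Fin n → Carrier A) →
              BooleanAlgebra._≈_ A (⟦ s ⟧ A ρ) (⟦ t ⟧ A ρ)

𝟚 : BooleanAlgebra 0ℓ 0ℓ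
𝟚 = ∨-∧-booleanAlgebra

-- The library's algebra of subsets of Fin m is 2^m: its carrier is Vec Bool m
-- with propositional equality, and its operations act coordinatewise.
Ω : ℕ → BooleanAlgebra 0ℓ 0ℓ
Ω n = ∪-∩-booleanAlgebra (2 ^ n)

record IsBooleanHomomorphism (A B : BooleanAlgebra 0ℓ 0ℓ)
                             (h : Carrier A → Carrier B) : Set where
  private
    module A = BooleanAlgebra A
    module B = BooleanAlgebra B
  field
    isLatticeHomomorphism : IsLatticeHomomorphism (rawLattice A) (rawLattice B) h
    ¬-homo                : ∀ x → h (A.¬ x) B.≈ B.¬ (h x)
    ⊤-homo                : h A.⊤ B.≈ B.⊤
    ⊥-homo                : h A.⊥ B.≈ B.⊥

-- The universal property is stated for the family b; since f may separate any
-- two indices, it forces the b i to be pairwise distinct.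
FreelyGenerates : ∀ {n} (A : BooleanAlgebra 0ℓ 0ℓ) → (Fin n → Carrier A) → Set₁
FreelyGenerates {n} A b =
  (B : BooleanAlgebra 0ℓ 0ℓ) (f : Fin n → Carrier B) →
  let open BooleanAlgebra B using (_≈_) in
  Σ[ h ∈ (Carrier A → Carrier B) ]
    IsBooleanHomomorphism A B h
    × (∀ i → h (b i) ≈ f i)
    × (∀ g → IsBooleanHomomorphism A B g → (∀ i → g (b i) ≈ f i) →
       ∀ x → g x ≈ h x)

literal : ∀ {n} → Fin n → Bool → Term n
literal i true  = var i
literal i false = ¬ᵗ var i

minterm : ∀ {n} → Vec Bool n → Term n
minterm μ = foldr _∧ᵗ_ ⊤ᵗ (tabulate λ i → literal i (lookup μ i))

sumOfMinterms : ∀ {n} → List (Vec Bool n) → Term n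
sumOfMinterms μs = foldr _∨ᵗ_ ⊥ᵗ (map minterm μs)

-- A full DNF is determined up to the order of its minterms: any duplicate-free
-- listing of the μ with t(μ) = 1 gives one.
data IsFullDNF {n} (t : Term n) : Term n → Set where
  isFullDNF : (μs : List (Vec Bool n)) → Unique μs →
              (∀ μ → μ ∈ μs ⇔ ⟦ t ⟧ 𝟚 (lookup μ) ≡ true) →
              IsFullDNF t (sumOfMinterms μs)

support : ∀ {m} → Vec Bool m → List (Fin m)
support {m} d = filter (λ j → lookup d j ≟ true) (allFin m)

-- (b₁(j), …, bₙ(j))
coordinates : ∀ {n m} → (Fin n → Vec Bool m) → Fin m → Vec Bool n
coordinates b j = Vec.tabulate λ i → lookup (b i) j

decode : ∀ {n m} → (Fin n → Vec Bool m) → Vec Bool m → Term n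
decode b d = sumOfMinterms (map (coordinates b) (support d))

{-# OPTIONS --safe #-}
-- Let π j : Ω n → 𝟚 be the j-th projection. It is a homomorphism, so d_j = 1
-- iff t holds at (b₁(j), …, bₙ(j)). Freeness makes j ↦ (b₁(j), …, bₙ(j)) a
-- bijection from the indices to 2ⁿ without any counting. Injectivity is the
-- uniqueness of extensions: projections that agree on the generators are equal,
-- and singletons separate projections. Surjectivity is the existence of
-- extensions: if no j is sent to μ, the minterm of μ evaluates to 0 in Ω n, yet
-- the homomorphism Ω n → 𝟚 that extends μ sends it to 1.
-- Hence t and the decoded form agree on 2ⁿ, so they take the same value at b,
-- and the homomorphisms from Ω n carry this equality to every Boolean algebra.
module Submission where

open import Defs
open import Algebra.Lattice.Bundles using (BooleanAlgebra)
open import Algebra.Lattice.Morphism.Structures using (IsLatticeHomomorphism)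
open import Data.Bool.Base using (Bool; true; false; not; _∨_; _∧_)
open import Data.Bool.Properties
  using (_≟_; T-≡; T-∧; T-∨; ⇔→≡; not-injective)
open import Data.Fin.Base using (Fin)
open import Data.Fin.Subset using (⁅_⁆)
open import Data.Fin.Subset.Properties
  using (∪-∩-booleanAlgebra; nonempty?; Empty-unique; x∈⁅x⁆; x∈⁅y⁆⇒x≡y)
open import Data.List.Base using (List; []; _∷_; foldr; map; allFin)
open import Data.List.Membership.Propositional using (_∈_)
open import Data.List.Membership.Propositional.Properties
  using (∈-map⁺; ∈-map⁻; ∈-filter⁺; ∈-filter⁻; ∈-allFin)
open import Data.List.Relation.Unary.All as All using (All; []; _∷_)
import Data.List.Relation.Unary.All.Properties as All
open import Data.List.Relation.Unary.Any as Any using (Any; here; there)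
import Data.List.Relation.Unary.Any.Properties as Any
import Data.List.Relation.Unary.Unique.Propositional.Properties as Unique
open import Data.Nat.Base using (ℕ; _≥_; _^_)
open import Data.Product.Base using (_×_; _,_; ∃; proj₂)
open import Data.Sum.Base using (inj₁; inj₂)
open import Data.Vec.Base using (Vec; lookup)
open import Data.Vec.Properties
  using (lookup-map; lookup-zipWith; lookup-replicate; lookup∘tabulate;
         tabulate∘lookup; tabulate-cong; []=⇒lookup; lookup⇒[]=)
open import Function.Base using (id; _∘_)
open import Function.Bundles using (_⇔_; mk⇔; module Equivalence)
open import Level using (0ℓ)
open import Relation.Binary.PropositionalEquality
  using (_≡_; refl; sym; trans; cong)
open import Relation.Nullary.Decidable using (yes; no)
open import Relation.Nullary.Negation using (contradiction)

open BooleanAlgebra using (Carrier)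
open Equivalence using (to; from)

private
  variable
    m n : ℕ

lookup-injective : {A : Set} (xs ys : Vec A n) →
                   (∀ i → lookup xs i ≡ lookup ys i) → xs ≡ ys
lookup-injective xs ys eq =
  trans (sym (tabulate∘lookup xs)) (trans (tabulate-cong eq) (tabulate∘lookup ys))

∧-true⁺ : ∀ {x y} → x ≡ true → y ≡ true → x ∧ y ≡ true
∧-true⁺ refl refl = refl

-- By induction on the term. Asking σ to match h ∘ ρ only up to equality in B covers both
-- projections and extensions obtained from freeness.
⟦⟧-homo : (A B : BooleanAlgebra 0ℓ 0ℓ) {h : Carrier A → Carrier B} →
          IsBooleanHomomorphism A B h →
          {ρ : Fin n → Carrier A} {σ : Fin n → Carrier B} →
          (∀ i → BooleanAlgebra._≈_ B (h (ρ i)) (σ i)) →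
          ∀ t → BooleanAlgebra._≈_ B (h (⟦ t ⟧ A ρ)) (⟦ t ⟧ B σ)
⟦⟧-homo A B {h} isHomo {ρ} {σ} h∘ρ≈σ = go
  where
  open BooleanAlgebra B using (_≈_; ∨-cong; ∧-cong; ¬-cong)
    renaming (trans to ≈-trans)
  open IsBooleanHomomorphism isHomo
  open IsLatticeHomomorphism isLatticeHomomorphism

  go : ∀ t → h (⟦ t ⟧ A ρ) ≈ ⟦ t ⟧ B σ
  go (var i)  = h∘ρ≈σ i
  go (s ∨ᵗ t) = ≈-trans (∨-homo _ _) (∨-cong (go s) (go t))
  go (s ∧ᵗ t) = ≈-trans (∧-homo _ _) (∧-cong (go s) (go t))
  go (¬ᵗ t)   = ≈-trans (¬-homo _) (¬-cong (go t))
  go ⊤ᵗ       = ⊤-homo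
  go ⊥ᵗ       = ⊥-homo

lookup-isBooleanHomomorphism :
  (j : Fin m) → IsBooleanHomomorphism (∪-∩-booleanAlgebra m) 𝟚 (λ x → lookup x j)
lookup-isBooleanHomomorphism j = record
  { isLatticeHomomorphism = record
    { isRelHomomorphism = record { cong = cong (λ x → lookup x j) }
    ; ∧-homo            = lookup-zipWith _∧_ j
    ; ∨-homo            = lookup-zipWith _∨_ j
    }
  ; ¬-homo = lookup-map j not
  ; ⊤-homo = lookup-replicate j true
  ; ⊥-homo = lookup-replicate j false
  }

infix 4 _⊨_
_⊨_ : Vec Bool n → Term n → Set
ν ⊨ t = ⟦ t ⟧ 𝟚 (lookup ν) ≡ true

lookup-⟦⟧ : (b : Fin n → Vec Bool m) (t : Term n) (j : Fin m) →
            lookup (⟦ t ⟧ (∪-∩-booleanAlgebra m) b) j ≡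
            ⟦ t ⟧ 𝟚 (lookup (coordinates b j))
lookup-⟦⟧ b t j = ⟦⟧-homo (∪-∩-booleanAlgebra _) 𝟚
  (lookup-isBooleanHomomorphism j) (λ i → sym (lookup∘tabulate _ i)) t

⊨-⋀ : (ν : Vec Bool n) (ts : List (Term n)) →
      ν ⊨ foldr _∧ᵗ_ ⊤ᵗ ts ⇔ All (ν ⊨_) ts
⊨-⋀ ν ts = mk⇔ (⇒ ts) ⇐
  where
  ⇒ : ∀ ts → ν ⊨ foldr _∧ᵗ_ ⊤ᵗ ts → All (ν ⊨_) ts
  ⇒ []       _ = []
  ⇒ (t ∷ ts) p with q , r ← to T-∧ (from T-≡ p) = to T-≡ q ∷ ⇒ ts (to T-≡ r)

  ⇐ : ∀ {ts} → All (ν ⊨_) ts → ν ⊨ foldr _∧ᵗ_ ⊤ᵗ ts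
  ⇐ []       = refl
  ⇐ (p ∷ ps) = ∧-true⁺ p (⇐ ps)

⊨-⋁ : (ν : Vec Bool n) (ts : List (Term n)) →
      ν ⊨ foldr _∨ᵗ_ ⊥ᵗ ts ⇔ Any (ν ⊨_) ts
⊨-⋁ ν ts = mk⇔ (⇒ ts) ⇐
  where
  ⇒ : ∀ ts → ν ⊨ foldr _∨ᵗ_ ⊥ᵗ ts → Any (ν ⊨_) ts
  -- The empty disjunction is false, so the case of the empty list is absurd.
  ⇒ (t ∷ ts) p with to T-∨ (from T-≡ p)
  ... | inj₁ q = here (to T-≡ q)
  ... | inj₂ q = there (⇒ ts (to T-≡ q))

  ⇐ : ∀ {ts} → Any (ν ⊨_) ts → ν ⊨ foldr _∨ᵗ_ ⊥ᵗ ts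
  ⇐ (here p)  = to T-≡ (from T-∨ (inj₁ (from T-≡ p)))
  ⇐ (there p) = to T-≡ (from T-∨ (inj₂ (from T-≡ (⇐ p))))

⊨-literal : (ν : Vec Bool n) (i : Fin n) (x : Bool) →
            ν ⊨ literal i x ⇔ lookup ν i ≡ x
⊨-literal ν i true  = mk⇔ id id
⊨-literal ν i false = mk⇔ not-injective (cong not)

-- Each literal pins one coordinate of ν, so all n literals together pin ν.
⊨-minterm : (ν μ : Vec Bool n) → ν ⊨ minterm μ ⇔ ν ≡ μ
⊨-minterm ν μ = mk⇔
  (λ p → lookup-injective ν μ λ i →
    to (⊨-literal ν i (lookup μ i)) (All.tabulate⁻ (to (⊨-⋀ ν _) p) i))
  (λ ν≡μ → from (⊨-⋀ ν _) (All.tabulate⁺ λ i →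
    from (⊨-literal ν i (lookup μ i)) (cong (λ v → lookup v i) ν≡μ)))

⊨-sumOfMinterms : (ν : Vec Bool n) (μs : List (Vec Bool n)) →
                  ν ⊨ sumOfMinterms μs ⇔ ν ∈ μs
⊨-sumOfMinterms ν μs = mk⇔
  (Any.map (to (⊨-minterm ν _)) ∘ Any.map⁻ ∘ to (⊨-⋁ ν _))
  (from (⊨-⋁ ν _) ∘ Any.map⁺ ∘ Any.map (from (⊨-minterm ν _)))

-- Truth of either side at ν amounts to ν occurring in the list, and Booleans that are true under
-- the same conditions are equal.
IsFullDNF-sound : {t s : Term n} → IsFullDNF t s →
                  ∀ ν → ⟦ t ⟧ 𝟚 (lookup ν) ≡ ⟦ s ⟧ 𝟚 (lookup ν)
IsFullDNF-sound (isFullDNF μs _ ∈⇔⊨) ν = ⇔→≡ (mk⇔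
  (from (⊨-sumOfMinterms ν μs) ∘ from (∈⇔⊨ ν))
  (to (∈⇔⊨ ν) ∘ to (⊨-sumOfMinterms ν μs)))

-- The length m is arbitrary here and becomes `2 ^ n` only in the final theorem.
module _ {b : Fin n → Vec Bool m}
         (free : FreelyGenerates (∪-∩-booleanAlgebra m) b) where

  coordinates-injective : ∀ {j k} → coordinates b j ≡ coordinates b k → j ≡ k
  -- Both projections extend the assignment i ↦ b_i(k), hence coincide; at `⁅ k ⁆` the k-th gives
  -- true, so the j-th does too.
  coordinates-injective {j} {k} eq with free 𝟚 (λ i → lookup (b i) k)
  ... | _ , _ , _ , unique = x∈⁅y⁆⇒x≡y k (lookup⇒[]= j ⁅ k ⁆
        (trans projections-agree ([]=⇒lookup (x∈⁅x⁆ k))))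
    where
    bⱼ≡bₖ : ∀ i → lookup (b i) j ≡ lookup (b i) k
    bⱼ≡bₖ i = trans (sym (lookup∘tabulate _ i))
      (trans (cong (λ v → lookup v i) eq) (lookup∘tabulate _ i))

    projections-agree : lookup ⁅ k ⁆ j ≡ lookup ⁅ k ⁆ k
    projections-agree = trans
      (unique (λ x → lookup x j) (lookup-isBooleanHomomorphism j) bⱼ≡bₖ ⁅ k ⁆)
      (sym (unique (λ x → lookup x k) (lookup-isBooleanHomomorphism k)
                   (λ _ → refl) ⁅ k ⁆))

  coordinates-surjective : ∀ μ → ∃ λ j → coordinates b j ≡ μ
  coordinates-surjective μ
    -- Nonemptiness of a finite subset is decidable, so the case split is constructive. At a member
    -- j the minterm of μ holds, which fixes the coordinates at j.
    with nonempty? (⟦ minterm μ ⟧ (∪-∩-booleanAlgebra m) b)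
  ... | yes (j , j∈p) = j , to (⊨-minterm _ μ)
        (trans (sym (lookup-⟦⟧ b (minterm μ) j)) ([]=⇒lookup j∈p))
  ... | no empty with h , isHomo , h∘b≡μ , _ ← free 𝟚 (lookup μ) =
        contradiction (trans (sym h-minterm≡true) h-minterm≡false) λ ()
    where
    open IsBooleanHomomorphism isHomo

    h-minterm≡true : h (⟦ minterm μ ⟧ (∪-∩-booleanAlgebra m) b) ≡ true
    h-minterm≡true = trans
      (⟦⟧-homo (∪-∩-booleanAlgebra m) 𝟚 isHomo h∘b≡μ (minterm μ))
      (from (⊨-minterm μ μ) refl)

    h-minterm≡false : h (⟦ minterm μ ⟧ (∪-∩-booleanAlgebra m) b) ≡ false
    h-minterm≡false = trans (cong h (Empty-unique empty)) ⊥-homo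

  -- Injectivity of `coordinates b` excludes repetitions; surjectivity ensures that no satisfying
  -- assignment is missed.
  decode-isFullDNF :
    ∀ t → IsFullDNF t (decode b (⟦ t ⟧ (∪-∩-booleanAlgebra m) b))
  decode-isFullDNF t = isFullDNF _
    (Unique.map⁺ coordinates-injective
      (Unique.filter⁺ (λ j → lookup d j ≟ true) (Unique.allFin⁺ m)))
    (λ μ → mk⇔ (⇒ μ) (⇐ μ))
    where
    d = ⟦ t ⟧ (∪-∩-booleanAlgebra m) b

    ⇒ : ∀ μ → μ ∈ map (coordinates b) (support d) → μ ⊨ t
    ⇒ μ μ∈ with j , j∈ , refl ← ∈-map⁻ (coordinates b) μ∈ = trans
      (sym (lookup-⟦⟧ b t j))
      (proj₂ (∈-filter⁻ (λ j → lookup d j ≟ true) {xs = allFin m} j∈))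

    ⇐ : ∀ μ → μ ⊨ t → μ ∈ map (coordinates b) (support d)
    ⇐ μ μ⊨t with j , refl ← coordinates-surjective μ = ∈-map⁺ (coordinates b)
      (∈-filter⁺ (λ j → lookup d j ≟ true) (∈-allFin j)
        (trans (lookup-⟦⟧ b t j) μ⊨t))

  -- Equality at b is checked coordinate by coordinate, where it becomes agreement in `𝟚`. By
  -- freeness any valuation ρ is the image of b under some h, which carries the equality to A.
  ≐-from-𝟚 : (s t : Term n) →
             (∀ ν → ⟦ s ⟧ 𝟚 (lookup ν) ≡ ⟦ t ⟧ 𝟚 (lookup ν)) → s ≐ t
  ≐-from-𝟚 s t eq A ρ with h , isHomo , h∘b≈ρ , _ ← free A ρ = begin
    ⟦ s ⟧ A ρ                             ≈⟨ h-⟦⟧ s ⟨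
    h (⟦ s ⟧ (∪-∩-booleanAlgebra m) b)    ≡⟨ cong h s≡t ⟩
    h (⟦ t ⟧ (∪-∩-booleanAlgebra m) b)    ≈⟨ h-⟦⟧ t ⟩
    ⟦ t ⟧ A ρ                             ∎
    where
    open import Relation.Binary.Reasoning.Setoid (BooleanAlgebra.setoid A)

    h-⟦⟧ = ⟦⟧-homo (∪-∩-booleanAlgebra m) A isHomo h∘b≈ρ

    s≡t : ⟦ s ⟧ (∪-∩-booleanAlgebra m) b ≡ ⟦ t ⟧ (∪-∩-booleanAlgebra m) b
    s≡t = lookup-injective _ _ λ j →
      trans (lookup-⟦⟧ b s j) (trans (eq (coordinates b j)) (sym (lookup-⟦⟧ b t j)))

proposition2p2 : (n : ℕ) → n ≥ 1 →
    (t : Term n) (b : Fin n → Vec Bool (2 ^ n)) →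
    FreelyGenerates (Ω n) b →
    let d = ⟦ t ⟧ (Ω n) b in
    IsFullDNF t (decode b d) × (t ≐ decode b d)
proposition2p2 n _ t b free =
  -- The identity follows from the first component, since a full DNF has the truth values of its
  -- term.
  fullDNF , ≐-from-𝟚 free t (decode b (⟦ t ⟧ (Ω n) b)) (IsFullDNF-sound fullDNF)
  where
  fullDNF : IsFullDNF t (decode b (⟦ t ⟧ (Ω n) b))
  fullDNF = decode-isFullDNF free t
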